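{- For all integers $k, N$ with $2\le k<N$, $$F_k(N)\le \binom{N-1}{k-1}+N-k.$$
   Context: For a positive integer $N$ let $[N]=\{1,2,\dots,N\}$, and let $\binom{[N]}{k}$ denote the family of all $k$-element subsets of $[N]$. For sets of integers $A,B$, the sumset is $A+B=\{a+b: a\in A, b\in B\}$. A family $\mathcal A=\{A_i: i\in I\}$ of (distinct) subsets of $\mathbb Z$ is a Sidon system if $A_i+A_j=A_{i'}+A_{j'}$ implies $\{i,j\}=\{i',j'\}$ for all $i,j,i',j'\in I$. For integers $N>k\ge 1$, $F_k(N)$ denotes the largest cardinality of a Sidon system $\mathcal A\subseteq\binom{[N]}{k}$. -}

module Defs where

open import Data.Bool.Base using (true; false; if_then_else_)
open import Data.Fin.Base using (Fin; zero; suc; toℕ; combine)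
import Data.Fin.Properties as Fin
open import Data.Fin.Subset using (Subset; ∣_∣)
import Data.Fin.Subset as Subset
open import Data.Fin.Subset.Properties using (anySubset?) renaming (_∈?_ to _∈ˢ?_)
open import Data.Integer.Base using (ℤ; +_; _+_)
import Data.Integer.Properties as ℤ
open import Data.Nat.Base using (ℕ; zero; suc; _^_; _≤_)
import Data.Nat.Properties as ℕ
open import Data.Product.Base using (∃; ∃-syntax; ∃₂; _×_; _,_)
open import Data.Vec.Base using (Vec; []; _∷_; lookup)
open import Function.Base using (_∘_)
open import Function.Definitions using (Injective)
open import Level using (0ℓ)
open import Relation.Binary.PropositionalEquality
  using (_≡_; refl; cong; subst)
open import Relation.Nullary.Decidable
  using (Dec; yes; no; does; map′; _×-dec_; _⊎-dec_; _→-dec_)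
open import Relation.Unary using (Pred; Decidable; _∈_; _∪_; _≐_; ｛_｝)

infixl 6 _⊕_

_⊕_ : Pred ℤ 0ℓ → Pred ℤ 0ℓ → Pred ℤ 0ℓ
(A ⊕ B) z = ∃₂ λ a b → a ∈ A × b ∈ B × z ≡ a + b

-- The first field says that the indexed sets are pairwise distinct, so that
-- a system indexed by Fin m has cardinality m.
record IsSidonSystem {I : Set} (A : I → Pred ℤ 0ℓ) : Set where
  field
    distinct : ∀ i j → A i ≐ A j → i ≡ j
    sidon    : ∀ i j i′ j′ → A i ⊕ A j ≐ A i′ ⊕ A j′ →
               (｛ i ｝ ∪ ｛ j ｝) ≐ (｛ i′ ｝ ∪ ｛ j′ ｝)

-- Subset N encodes the subsets of [N] = {1, …, N}: the index x : Fin N,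
-- which counts from 0, stands for the integer x + 1.
⟦_⟧ : ∀ {N} → Subset N → Pred ℤ 0ℓ
⟦ p ⟧ z = ∃[ x ] x Subset.∈ p × z ≡ + suc (toℕ x)

IsSidonSystemIn : (k N : ℕ) {m : ℕ} → Vec (Subset N) m → Set
IsSidonSystemIn k N A =
  (∀ i → ∣ lookup A i ∣ ≡ k) × IsSidonSystem (λ i → ⟦ lookup A i ⟧)

HasSidonSystem : (k N m : ℕ) → Set
HasSidonSystem k N m = ∃[ A ] IsSidonSystemIn k N {m} A

⟦⟧-⊆? : ∀ {N} (p q : Subset N) → Dec (∀ {z} → z ∈ ⟦ p ⟧ → z ∈ ⟦ q ⟧)
⟦⟧-⊆? p q = map′
  (λ { f (x , x∈p , refl) → f x x∈p })
  (λ f x x∈p → f (x , x∈p , refl))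
  (Fin.all? λ x → (x ∈ˢ? p) →-dec
    Fin.any? λ y → (y ∈ˢ? q) ×-dec (+ suc (toℕ x) ℤ.≟ + suc (toℕ y)))

⊕-∈? : ∀ {N} (p q : Subset N) → Decidable (⟦ p ⟧ ⊕ ⟦ q ⟧)
⊕-∈? p q z = map′
  (λ { (x , y , x∈p , y∈q , eq) →
       _ , _ , (x , x∈p , refl) , (y , y∈q , refl) , eq })
  (λ { (_ , _ , (x , x∈p , refl) , (y , y∈q , refl) , eq) →
       x , y , x∈p , y∈q , eq })
  (Fin.any? λ x → Fin.any? λ y →
    (x ∈ˢ? p) ×-dec (y ∈ˢ? q) ×-dec
    (z ℤ.≟ + suc (toℕ x) + + suc (toℕ y)))

⊕-⊆? : ∀ {N} (p q r s : Subset N) →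
       Dec (∀ {z} → z ∈ ⟦ p ⟧ ⊕ ⟦ q ⟧ → z ∈ ⟦ r ⟧ ⊕ ⟦ s ⟧)
⊕-⊆? p q r s = map′
  (λ { f (_ , _ , (x , x∈p , refl) , (y , y∈q , refl) , refl) →
       f x y x∈p y∈q })
  (λ f x y x∈p y∈q →
       f (_ , _ , (x , x∈p , refl) , (y , y∈q , refl) , refl))
  (Fin.all? λ x → Fin.all? λ y →
    (x ∈ˢ? p) →-dec (y ∈ˢ? q) →-dec
    ⊕-∈? r s (+ suc (toℕ x) + + suc (toℕ y)))

pair-⊆? : ∀ {m} (i j i′ j′ : Fin m) →
          Dec (∀ {l} → l ∈ ｛ i ｝ ∪ ｛ j ｝ → l ∈ ｛ i′ ｝ ∪ ｛ j′ ｝)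
pair-⊆? i j i′ j′ = map′ (λ f {l} → f l) (λ f l → f {l})
  (Fin.all? λ l → ((i Fin.≟ l) ⊎-dec (j Fin.≟ l)) →-dec
                  ((i′ Fin.≟ l) ⊎-dec (j′ Fin.≟ l)))

isSidonSystemIn? : ∀ k N {m} → Decidable (IsSidonSystemIn k N {m})
isSidonSystemIn? k N A =
  Fin.all? (λ i → ∣ lookup A i ∣ ℕ.≟ k) ×-dec
  map′
    (λ (d , s) → record { distinct = d ; sidon = s })
    (λ S → IsSidonSystem.distinct S , IsSidonSystem.sidon S)
    ((Fin.all? λ i → Fin.all? λ j →
        (⟦⟧-⊆? (B i) (B j) ×-dec ⟦⟧-⊆? (B j) (B i)) →-dec (i Fin.≟ j))
     ×-dec
     (Fin.all? λ i → Fin.all? λ j → Fin.all? λ i′ → Fin.all? λ j′ →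
        (⊕-⊆? (B i) (B j) (B i′) (B j′) ×-dec ⊕-⊆? (B i′) (B j′) (B i) (B j))
        →-dec
        (pair-⊆? i j i′ j′ ×-dec pair-⊆? i′ j′ i j)))
  where
  B : _ → Subset N
  B = lookup A

anyVec? : ∀ {N m} {P : Pred (Vec (Subset N) m) 0ℓ} → Decidable P → Dec (∃ P)
anyVec? {m = zero}  P? = map′ ([] ,_) (λ { ([] , h) → h }) (P? [])
anyVec? {m = suc m} P? = map′
  (λ (p , A , h) → p ∷ A , h)
  (λ { (p ∷ A , h) → p , A , h })
  (anySubset? λ p → anyVec? λ A → P? (p ∷ A))

hasSidonSystem? : ∀ k N → Decidable (HasSidonSystem k N)
hasSidonSystem? k N m = anyVec? (isSidonSystemIn? k N)

-- The largest m ≤ b satisfying P, or 0 if there is none.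
greatest : {P : Pred ℕ 0ℓ} → Decidable P → ℕ → ℕ
greatest P? zero    = zero
greatest P? (suc b) = if does (P? (suc b)) then suc b else greatest P? b

-- The search may stop at 2 ^ N, the number of all subsets of [N];
-- F-attained and F-maximal confirm that F k N is the maximum over all m.
F : (k N : ℕ) → ℕ
F k N = greatest (hasSidonSystem? k N) (2 ^ N)

greatest-attained : {P : Pred ℕ 0ℓ} (P? : Decidable P) → P 0 →
                    ∀ b → P (greatest P? b)
greatest-attained P? p₀ zero = p₀
greatest-attained P? p₀ (suc b) with P? (suc b)
... | yes p = p
... | no  _ = greatest-attained P? p₀ b

greatest-maximal : {P : Pred ℕ 0ℓ} (P? : Decidable P) →
                   ∀ b {m} → m ≤ b → P m → m ≤ greatest P? b
greatest-maximal P? zero    m≤b p = m≤b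
greatest-maximal P? (suc b) {m} m≤b p with P? (suc b)
... | yes _ = m≤b
... | no ¬p = greatest-maximal P? b
  (ℕ.≤-pred (ℕ.≤∧≢⇒< m≤b λ { refl → ¬p p })) p

encode : ∀ {N} → Subset N → Fin (2 ^ N)
encode []          = zero
encode (true  ∷ p) = combine {2} (suc zero) (encode p)
encode (false ∷ p) = combine {2} zero (encode p)

encode-injective : ∀ {N} → Injective _≡_ _≡_ (encode {N})
encode-injective {x = []} {[]} _ = refl
encode-injective {x = true ∷ p} {true ∷ q} eq =
  cong (true ∷_) (encode-injective
    (Fin.combine-injectiveʳ {2} (suc zero) (encode p) (suc zero) (encode q) eq))
encode-injective {x = false ∷ p} {false ∷ q} eq =
  cong (false ∷_) (encode-injective
    (Fin.combine-injectiveʳ {2} zero (encode p) zero (encode q) eq))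
encode-injective {x = true ∷ p} {false ∷ q} eq
  with () ← Fin.combine-injectiveˡ {2} (suc zero) (encode p) zero (encode q) eq
encode-injective {x = false ∷ p} {true ∷ q} eq
  with () ← Fin.combine-injectiveˡ {2} zero (encode p) (suc zero) (encode q) eq

hasSidonSystem⇒≤ : ∀ k N {m} → HasSidonSystem k N m → m ≤ 2 ^ N
hasSidonSystem⇒≤ k N (A , _ , S) = Fin.injective⇒≤ {f = encode ∘ lookup A}
  λ {i} {j} eq → IsSidonSystem.distinct S i j
    (subst (λ p → ⟦ lookup A i ⟧ ≐ ⟦ p ⟧) (encode-injective eq)
      ((λ z∈ → z∈) , λ z∈ → z∈))

F-attained : ∀ k N → HasSidonSystem k N (F k N)
F-attained k N = greatest-attained (hasSidonSystem? k N)
  ([] , (λ ()) , record { distinct = λ () ; sidon = λ () }) (2 ^ N)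

F-maximal : ∀ k N m → HasSidonSystem k N m → m ≤ F k N
F-maximal k N m h =
  greatest-maximal (hasSidonSystem? k N) (2 ^ N) (hasSidonSystem⇒≤ k N h) h

{-# OPTIONS --safe #-}
-- Sort the members of a Sidon system by their translation class. A class of
-- k-subsets of [N] is represented by a set with minimum 1, so there are at most
-- C(N-1, k-1) classes. If A = A₀ + d and B = B₀ + d, then A + B₀ = B + A₀, so a
-- difference d > 0 between two members of one class determines the larger one.
-- Hence sending a member to such a difference d ≤ N - k if there is one, and to
-- its class otherwise, is injective.
module Submission where

open import Defs
open import Data.Bool.Base using (true; false)
open import Data.Bool.Properties using () renaming (_≟_ to _≟ᵇ_)
open import Data.Fin.Base using (Fin; zero; suc; toℕ; fromℕ<; inject₁; join; splitAt)
import Data.Fin.Properties as Fin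
open import Data.Fin.Subset using (Subset; ∣_∣; _∈_)
import Data.Integer.Base as ℤ
open import Data.Nat.Base
  using (ℕ; zero; suc; pred; _+_; _∸_; _≤_; _<_; z≤n; s≤s)
open import Data.Nat.Combinatorics
  using (_C_; nCk+nC[k+1]≡[n+1]C[k+1])
import Data.Nat.Properties as ℕ
open import Data.Product.Base using (∃-syntax; _×_; _,_; proj₁; proj₂)
open import Data.Sum.Base using (_⊎_; inj₁; inj₂)
open import Data.Sum.Properties using (inj₁-injective; inj₂-injective)
open import Data.Vec.Base using (Vec; []; _∷_; _∷ʳ_; lookup; here; there)
open import Data.Vec.Properties using (≡-dec)
open import Relation.Binary.Definitions using (tri<; tri≈; tri>)
open import Relation.Binary.PropositionalEquality
open import Relation.Nullary using (Dec; yes; no; ¬_; contradiction)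
open import Relation.Nullary.Decidable using (_×-dec_)
import Relation.Unary as U
open import Algebra.Properties.CommutativeSemigroup ℕ.+-commutativeSemigroup
  using (interchange)

-- Ranking the subsets of a fixed size.

nCk≤[1+n]Ck : ∀ n k → n C k ≤ suc n C k
nCk≤[1+n]Ck n zero    = ℕ.≤-refl
nCk≤[1+n]Ck n (suc k) = subst (n C suc k ≤_)
  (nCk+nC[k+1]≡[n+1]C[k+1] n k) (ℕ.m≤n+m (n C suc k) (n C k))

-- The position of p in the combinatorial number system.
rank : ∀ {n} → Subset n → ℕ
rank         []          = 0
rank {suc n} (true ∷ p)  = n C suc ∣ p ∣ + rank p
rank         (false ∷ p) = rank p

-- Pascal's rule: among sets of size `suc k`, those avoiding the first point have ranks below
-- `n C suc k`, and those containing it fill the next `n C k` values.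
rank<nC∣p∣ : ∀ {n} (p : Subset n) → rank p < n C ∣ p ∣
rank<nC∣p∣         []          = s≤s z≤n
rank<nC∣p∣ {suc n} (true ∷ p)  = begin-strict
  n C suc ∣ p ∣ + rank p       <⟨ ℕ.+-monoʳ-< (n C suc ∣ p ∣) (rank<nC∣p∣ p) ⟩
  n C suc ∣ p ∣ + n C ∣ p ∣    ≡⟨ ℕ.+-comm (n C suc ∣ p ∣) (n C ∣ p ∣) ⟩
  n C ∣ p ∣ + n C suc ∣ p ∣    ≡⟨ nCk+nC[k+1]≡[n+1]C[k+1] n ∣ p ∣ ⟩
  suc n C suc ∣ p ∣            ∎
  where open ℕ.≤-Reasoning
rank<nC∣p∣ {suc n} (false ∷ p) =
  ℕ.<-≤-trans (rank<nC∣p∣ p) (nCk≤[1+n]Ck n ∣ p ∣)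

rank-false<rank-true : ∀ {n} (p q : Subset n) → ∣ p ∣ ≡ suc ∣ q ∣ →
                       rank (false ∷ p) < rank (true ∷ q)
rank-false<rank-true {n} p q eq = ℕ.<-≤-trans
  (subst (λ k → rank p < n C k) eq (rank<nC∣p∣ p)) (ℕ.m≤m+n _ (rank q))

-- The sizes have to agree, since terminal segments of every size have rank 0.
rank-injective : ∀ {n} (p q : Subset n) → ∣ p ∣ ≡ ∣ q ∣ → rank p ≡ rank q → p ≡ q
rank-injective [] [] _ _ = refl
rank-injective {suc n} (true ∷ p) (true ∷ q) c r = cong (true ∷_)
  (rank-injective p q ∣p∣≡∣q∣ (ℕ.+-cancelˡ-≡ (n C suc ∣ p ∣) _ _
    (trans r (cong (λ k → n C suc k + rank q) (sym ∣p∣≡∣q∣)))))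
  where
  ∣p∣≡∣q∣ : ∣ p ∣ ≡ ∣ q ∣
  ∣p∣≡∣q∣ = ℕ.suc-injective c
rank-injective (false ∷ p) (false ∷ q) c r = cong (false ∷_) (rank-injective p q c r)
rank-injective (true ∷ p) (false ∷ q) c r =
  contradiction (sym r) (ℕ.<⇒≢ (rank-false<rank-true q p (sym c)))
rank-injective (false ∷ p) (true ∷ q) c r =
  contradiction r (ℕ.<⇒≢ (rank-false<rank-true p q c))

-- Normal form of a set up to translation.

∈-∷ʳ⁺ : ∀ {n} {p : Subset n} {x b} → x ∈ p → inject₁ x ∈ p ∷ʳ b
∈-∷ʳ⁺ here        = here
∈-∷ʳ⁺ (there x∈p) = there (∈-∷ʳ⁺ x∈p)

∈-∷ʳfalse⁻ : ∀ {n} (p : Subset n) {x} → x ∈ p ∷ʳ false →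
             ∃[ y ] y ∈ p × toℕ x ≡ toℕ y
∈-∷ʳfalse⁻ []      (there ())
∈-∷ʳfalse⁻ (_ ∷ p) here        = zero , here , refl
∈-∷ʳfalse⁻ (_ ∷ p) (there x∈p) with ∈-∷ʳfalse⁻ p x∈p
... | y , y∈p , eq = suc y , there y∈p , cong suc eq

∣p∷ʳfalse∣≡∣p∣ : ∀ {n} (p : Subset n) → ∣ p ∷ʳ false ∣ ≡ ∣ p ∣
∣p∷ʳfalse∣≡∣p∣ []          = refl
∣p∷ʳfalse∣≡∣p∣ (true ∷ p)  = cong suc (∣p∷ʳfalse∣≡∣p∣ p)
∣p∷ʳfalse∣≡∣p∣ (false ∷ p) = ∣p∷ʳfalse∣≡∣p∣ p

-- A nonempty p is the translate by offset p of true ∷ shape p; for empty p both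
-- functions return junk.
offset : ∀ {n} → Subset (suc n) → ℕ
offset         (true ∷ p)  = 0
offset {zero}  (false ∷ p) = 0
offset {suc n} (false ∷ p) = suc (offset p)

shape : ∀ {n} → Subset (suc n) → Subset n
shape         (true ∷ p)  = p
shape {zero}  (false ∷ p) = []
shape {suc n} (false ∷ p) = shape p ∷ʳ false

∣shape∣ : ∀ {n} (p : Subset (suc n)) → ∣ shape p ∣ ≡ pred ∣ p ∣
∣shape∣         (true ∷ p)   = refl
∣shape∣ {zero}  (false ∷ []) = refl
∣shape∣ {suc n} (false ∷ p)  = trans (∣p∷ʳfalse∣≡∣p∣ (shape p)) (∣shape∣ p)

-- The induction runs on the additive form: a leading `false` before a nonempty vector adds one to
-- both the offset and `n` and keeps the size of the shape.
offset≤n∸∣shape∣ : ∀ {n} (p : Subset (suc n)) → offset p ≤ n ∸ ∣ shape p ∣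
offset≤n∸∣shape∣ p = ℕ.m+n≤o⇒m≤o∸n (offset p) (offset+∣shape∣≤n p)
  where
  ∣p∣≤n : ∀ {n} (p : Subset n) → ∣ p ∣ ≤ n
  ∣p∣≤n []          = z≤n
  ∣p∣≤n (true ∷ p)  = s≤s (∣p∣≤n p)
  ∣p∣≤n (false ∷ p) = ℕ.m≤n⇒m≤1+n (∣p∣≤n p)

  offset+∣shape∣≤n : ∀ {n} (p : Subset (suc n)) → offset p + ∣ shape p ∣ ≤ n
  offset+∣shape∣≤n         (true ∷ p)   = ∣p∣≤n p
  offset+∣shape∣≤n {zero}  (false ∷ []) = z≤n
  offset+∣shape∣≤n {suc n} (false ∷ p)  = s≤s
    (subst (λ k → offset p + k ≤ n) (sym (∣p∷ʳfalse∣≡∣p∣ (shape p)))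
      (offset+∣shape∣≤n p))

∈⇒∈shape : ∀ {n} (p : Subset (suc n)) {x} → x ∈ p →
           ∃[ y ] y ∈ true ∷ shape p × toℕ x ≡ offset p + toℕ y
∈⇒∈shape         (true ∷ p)  {x} x∈p = x , x∈p , refl
∈⇒∈shape {zero}  (false ∷ []) (there ())
∈⇒∈shape {suc n} (false ∷ p) (there x∈p) with ∈⇒∈shape p x∈p
... | y , y∈ , eq = inject₁ y , ∈-∷ʳ⁺ y∈ ,
  cong suc (trans eq (cong (_+_ (offset p)) (sym (Fin.toℕ-inject₁ y))))

-- The size hypothesis excludes the empty set, for which `true ∷ shape p` still has a point.
∈shape⇒∈ : ∀ {n k} (p : Subset (suc n)) → ∣ p ∣ ≡ suc k → ∀ {y} →
           y ∈ true ∷ shape p → ∃[ x ] x ∈ p × toℕ x ≡ offset p + toℕ y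
∈shape⇒∈ (true ∷ p) c {y} y∈ = y , y∈ , refl
∈shape⇒∈ {zero} (false ∷ []) ()
∈shape⇒∈ {suc n} (false ∷ p) c y∈ with ∈-∷ʳfalse⁻ (true ∷ shape p) y∈
... | y′ , y′∈ , eq with ∈shape⇒∈ p c y′∈
... | x , x∈p , eq′ = suc x , there x∈p ,
  cong suc (trans eq′ (cong (_+_ (offset p)) (sym eq)))

shape-offset-injective : ∀ {n k} (p q : Subset (suc n)) →
                         ∣ p ∣ ≡ suc k → ∣ q ∣ ≡ suc k →
                         shape p ≡ shape q → offset p ≡ offset q → ⟦ p ⟧ U.≐ ⟦ q ⟧
shape-offset-injective p q cp cq s o =
  incl p q cq s o , incl q p cp (sym s) (sym o)
  where
  incl : ∀ {n k} (p q : Subset (suc n)) → ∣ q ∣ ≡ suc k →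
         shape p ≡ shape q → offset p ≡ offset q → ⟦ p ⟧ U.⊆ ⟦ q ⟧
  incl p q c s o (x , x∈p , refl) with ∈⇒∈shape p x∈p
  ... | y , y∈ , eq with ∈shape⇒∈ q c (subst (λ r → y ∈ true ∷ r) s y∈)
  ... | x′ , x′∈q , eq′ = x′ , x′∈q ,
    cong (λ t → ℤ.+ suc t) (trans eq (trans (cong (_+ toℕ y) o) (sym eq′)))

-- With P and Q the normal forms shared by `p`, `p′` and by `q`, `q′`, both sumsets are P + Q
-- shifted by the same total offset. Pointwise, a in P moves from `p` to `p′` and b in Q from `q′`
-- to `q`.
⊕-exchange : ∀ {n k} (p p′ q q′ : Subset (suc n)) →
             ∣ p′ ∣ ≡ suc k → ∣ q ∣ ≡ suc k →
             shape p ≡ shape p′ → shape q ≡ shape q′ →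
             offset p + offset q′ ≡ offset q + offset p′ →
             ⟦ p ⟧ ⊕ ⟦ q′ ⟧ U.⊆ ⟦ q ⟧ ⊕ ⟦ p′ ⟧
⊕-exchange p p′ q q′ cp′ cq sp sq o
  (_ , _ , (x , x∈p , refl) , (y , y∈q′ , refl) , refl)
  with ∈⇒∈shape p x∈p | ∈⇒∈shape q′ y∈q′
... | a , a∈ , x≡ | b , b∈ , y≡
  with ∈shape⇒∈ p′ cp′ (subst (λ r → a ∈ true ∷ r) sp a∈)
     | ∈shape⇒∈ q cq (subst (λ r → b ∈ true ∷ r) (sym sq) b∈)
... | u , u∈p′ , u≡ | v , v∈q , v≡ =
  _ , _ , (v , v∈q , refl) , (u , u∈p′ , refl) , cong ℤ.+_ sum≡
  where
  open ≡-Reasoning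
  sum≡ : suc (toℕ x) + suc (toℕ y) ≡ suc (toℕ v) + suc (toℕ u)
  sum≡ = cong suc (begin
    toℕ x + suc (toℕ y)
      ≡⟨ ℕ.+-suc (toℕ x) (toℕ y) ⟩
    suc (toℕ x + toℕ y)
      ≡⟨ cong suc (cong₂ _+_ x≡ y≡) ⟩
    suc ((offset p + toℕ a) + (offset q′ + toℕ b))
      ≡⟨ cong suc (interchange (offset p) (toℕ a) (offset q′) (toℕ b)) ⟩
    suc ((offset p + offset q′) + (toℕ a + toℕ b))
      ≡⟨ cong suc (cong₂ _+_ o (ℕ.+-comm (toℕ a) (toℕ b))) ⟩
    suc ((offset q + offset p′) + (toℕ b + toℕ a))
      ≡⟨ cong suc (interchange (offset q) (offset p′) (toℕ b) (toℕ a)) ⟩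
    suc ((offset q + toℕ b) + (offset p′ + toℕ a))
      ≡⟨ cong suc (cong₂ _+_ v≡ u≡) ⟨
    suc (toℕ v + toℕ u)
      ≡⟨ ℕ.+-suc (toℕ v) (toℕ u) ⟨
    toℕ v + suc (toℕ u) ∎)

-- Injective coding of a Sidon system.

module _ {k n m : ℕ} (A : Vec (Subset (suc n)) m)
         (sys : IsSidonSystemIn (suc k) (suc n) A) where

  open IsSidonSystem (proj₂ sys)

  size : ∀ i → ∣ lookup A i ∣ ≡ suc k
  size = proj₁ sys

  off : Fin m → ℕ
  off i = offset (lookup A i)

  shp : Fin m → Subset n
  shp i = shape (lookup A i)

  ∣shp∣ : ∀ i → ∣ shp i ∣ ≡ k
  ∣shp∣ i = trans (∣shape∣ (lookup A i)) (cong pred (size i))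

  off≤n∸k : ∀ i → off i ≤ n ∸ k
  off≤n∸k i = subst (λ l → off i ≤ n ∸ l) (∣shp∣ i) (offset≤n∸∣shape∣ (lookup A i))

  LowerTranslate : Fin m → Fin m → Set
  LowerTranslate i j = shp i ≡ shp j × off j < off i

  lowerTranslate? : ∀ i → Dec (∃[ j ] LowerTranslate i j)
  lowerTranslate? i = Fin.any? λ j →
    ≡-dec _≟ᵇ_ (shp i) (shp j) ×-dec (off j ℕ.<? off i)

  class : Fin m → Fin (n C k)
  class i = fromℕ< (subst (λ l → rank (shp i) < n C l) (∣shp∣ i) (rank<nC∣p∣ (shp i)))

  class-injective : ∀ i j → class i ≡ class j → shp i ≡ shp j
  class-injective i j eq = rank-injective (shp i) (shp j)
    (trans (∣shp∣ i) (sym (∣shp∣ j))) (Fin.fromℕ<-injective _ _ _ _ eq)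

  -- If the offsets differed, the lower member would be a lower translate of the other.
  lowest-unique : ∀ i j → shp i ≡ shp j → ¬ (∃[ l ] LowerTranslate i l) →
                  ¬ (∃[ l ] LowerTranslate j l) → i ≡ j
  lowest-unique i j s ¬i ¬j with ℕ.<-cmp (off i) (off j)
  ... | tri< lt _ _ = contradiction (i , sym s , lt) ¬j
  ... | tri> _ _ gt = contradiction (j , s , gt) ¬i
  ... | tri≈ _ o _  = distinct i j
    (shape-offset-injective (lookup A i) (lookup A j) (size i) (size j) s o)

  gap : ∀ {i j} → LowerTranslate i j → Fin (n ∸ k)
  -- The difference d of the offsets satisfies 1 ≤ d ≤ `n ∸ k`, so d - 1 is stored to fit in
  -- `Fin (n ∸ k)`.
  gap {i} {j} (_ , lt) = fromℕ< {off i ∸ suc (off j)}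
    (ℕ.<-≤-trans (ℕ.∸-monoʳ-< (s≤s z≤n) lt) (off≤n∸k i))

  -- The two pairs may come from different classes. Equal gaps give equal cross sums of offsets, so
  -- `⊕-exchange` in both directions equates the sumsets for `i`, `j₀` and for `j`, `i₀`; the Sidon
  -- property then forces `i` to be `j` or `i₀`.
  gap-injective : ∀ {i i₀ j j₀} (ti : LowerTranslate i i₀) (tj : LowerTranslate j j₀) →
                  gap ti ≡ gap tj → i ≡ j
  gap-injective {i} {i₀} {j} {j₀} (si , i₀<i) (sj , j₀<j) eq
    with proj₁ (sidon i j₀ j i₀
      ( ⊕-exchange (lookup A i) (lookup A i₀) (lookup A j) (lookup A j₀)
          (size i₀) (size j) si sj o
      , ⊕-exchange (lookup A j) (lookup A j₀) (lookup A i) (lookup A i₀)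
          (size j₀) (size i) sj si (sym o))) {i} (inj₁ refl)
    where
    g : ℕ
    g = off i ∸ suc (off i₀)
    o : off i + off j₀ ≡ off j + off i₀
    o = begin
      off i + off j₀                ≡⟨ cong (_+ off j₀) (ℕ.m∸n+n≡m i₀<i) ⟨
      g + suc (off i₀) + off j₀     ≡⟨ swap g (off i₀) (off j₀) ⟩
      g + suc (off j₀) + off i₀
        ≡⟨ cong (λ h → h + suc (off j₀) + off i₀) (Fin.fromℕ<-injective _ _ _ _ eq) ⟩
      off j ∸ suc (off j₀) + suc (off j₀) + off i₀
                                    ≡⟨ cong (_+ off i₀) (ℕ.m∸n+n≡m j₀<j) ⟩
      off j + off i₀                ∎
      where
      open ≡-Reasoning
      swap : ∀ a b c → a + suc b + c ≡ a + suc c + b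
      swap a b c = begin
        a + suc b + c    ≡⟨ ℕ.+-assoc a (suc b) c ⟩
        a + suc (b + c)  ≡⟨ cong (λ d → a + suc d) (ℕ.+-comm b c) ⟩
        a + suc (c + b)  ≡⟨ ℕ.+-assoc a (suc c) b ⟨
        a + suc c + b    ∎
  ... | inj₁ j≡i  = sym j≡i
  -- `i` cannot be `i₀`, whose offset is strictly smaller.
  ... | inj₂ refl = contradiction i₀<i (ℕ.<-irrefl refl)

  -- Whichever lower translate the search returns will do: `gap-injective` recovers `i` for any
  -- choice of witnesses.
  code : Fin m → Fin (n C k) ⊎ Fin (n ∸ k)
  code i with lowerTranslate? i
  ... | yes (_ , t) = inj₂ (gap t)
  ... | no _        = inj₁ (class i)

  code-injective : ∀ {i j} → code i ≡ code j → i ≡ j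
  code-injective {i} {j} eq with lowerTranslate? i | lowerTranslate? j
  ... | yes (_ , ti) | yes (_ , tj) = gap-injective ti tj (inj₂-injective eq)
  ... | no ¬i        | no ¬j        =
    lowest-unique i j (class-injective i j (inj₁-injective eq)) ¬i ¬j
  code-injective () | yes _ | no _
  code-injective () | no _  | yes _

  -- Here `k` and `n` are one less than the set size and the length of the interval, so the summands
  -- count the classes and the possible differences.
  system-size≤ : m ≤ n C k + (n ∸ k)
  system-size≤ = Fin.injective⇒≤ {f = λ i → join (n C k) (n ∸ k) (code i)}
    λ {i} {j} eq → code-injective (begin
      code i
        ≡⟨ Fin.splitAt-join (n C k) (n ∸ k) (code i) ⟨
      splitAt (n C k) (join (n C k) (n ∸ k) (code i))
        ≡⟨ cong (splitAt (n C k)) eq ⟩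
      splitAt (n C k) (join (n C k) (n ∸ k) (code j))
        ≡⟨ Fin.splitAt-join (n C k) (n ∸ k) (code j) ⟩
      code j ∎)
    where open ≡-Reasoning

theorem1p3 : (k N : ℕ) → 2 ≤ k → k < N →
    F k N ≤ ((N ∸ 1) C (k ∸ 1)) + (N ∸ k)
theorem1p3 (suc k) (suc n) 2≤k k<N = system-size≤ (proj₁ attained) (proj₂ attained)
  where
  attained : HasSidonSystem (suc k) (suc n) (F (suc k) (suc n))
  attained = F-attained (suc k) (suc n)
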